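{- Let $N\ge 1$ and let $\phi^3$ be the $\mathcal{T}$-formula, defined in the context, that is the cubic-size partial-order encoding of the $N$-thread challenge problem. Then every Fixed-Alphabet-DPLL($\mathcal{T}$) proof that $\phi^3$ is unsatisfiable contains at least $N!$ applications of the rule $\mathcal{T}$-learn.
   Context: Challenge problem. A shared memory location $x$ initially holds $0$. Thread $T_0$ reads $[x]$ into $v_0$ (read event $r_{assert}$) and asserts $v_0\le N$. For $i=1,\dots,N$, thread $T_i$ reads $[x]$ into $v_i$ (read event $r_i$) and then writes $v_i+1$ to $x$ (write event $w_i$). The initialization is a write event $w_{init}$. Put $\mathsf{R}=\{r_1,\dots,r_N,r_{assert}\}$, $\mathsf{W}=\{w_{init},w_1,\dots,w_N\}$, $\mathsf{E}=\mathsf{R}\cup\mathsf{W}$, so $|\mathsf{E}|=2N+2$. Theories. $\mathcal{T}=\mathcal{T}_C+\mathcal{T}_V+\mathcal{T}_S$ is the standard combined (many-sorted, with separate sorts for clocks, values and selections) theory, where: $\mathcal{T}_C$ (clocks) has a strict order relation $\prec$ that is a total order; $\mathcal{T}_V$ (values) is bit-vector, Presburger, or real arithmetic; $\mathcal{T}_S$ (selection) is an uninterpreted theory (with equality). It is assumed that $\mathcal{T}$ has a model whose clock domain has at least $|\mathsf{E}|$ elements and whose selection domain has at least $N+1$ elements, and, if $\mathcal{T}_V$ is bit-vector arithmetic, that the bit-width is large enough that the constants $0,1,\dots,N+1$ are represented as distinct values in their usual order, without overflow. Variables: a $\mathcal{T}_C$-variable $\mathsf{c}_e$ and a $\mathcal{T}_S$-variable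 $\mathsf{s}_e$ for each $e\in\mathsf{E}$, and a $\mathcal{T}_V$-variable $\mathsf{rv}_r$ for each $r\in\mathsf{R}$. Formula. $\phi^3$ is the conjunction of the following clauses (implications are read as clauses, $a\neq b$ is the negation of the atom $a=b$, and the atoms $a=b$ and $b=a$ are identified): 1. $\mathsf{c}_{w_{init}}\prec\mathsf{c}_{r_{assert}}$; and $\mathsf{c}_{w_{init}}\prec\mathsf{c}_{r_i}$, $\mathsf{c}_{r_i}\prec\mathsf{c}_{w_i}$ for $i=1,\dots,N$; 2. $\mathsf{c}_w\neq\mathsf{c}_{w'}$ and $\mathsf{s}_w\neq\mathsf{s}_{w'}$ for all $w\neq w'$ in $\mathsf{W}$; 3. $\mathsf{c}_w\neq\mathsf{c}_r$ for all $w\in\mathsf{W}$, $r\in\mathsf{R}$; 4. $(\mathsf{s}_w=\mathsf{s}_r)\Rightarrow\mathsf{c}_w\prec\mathsf{c}_r$ for all $w\in\mathsf{W}$, $r\in\mathsf{R}$; 5. $(\mathsf{s}_{w_{init}}=\mathsf{s}_r)\Rightarrow 0=\mathsf{rv}_r$ for all $r\in\mathsf{R}$; 6. $(\mathsf{s}_{w_i}=\mathsf{s}_r)\Rightarrow\mathsf{rv}_{r_i}+1=\mathsf{rv}_r$ for all $i=1,\dots,N$, $r\in\mathsf{R}$; 7. $(\mathsf{s}_w=\mathsf{s}_r\land\mathsf{c}_w\prec\mathsf{c}_{w'})\Rightarrow\mathsf{c}_r\prec\mathsf{c}_{w'}$ for all $w,w'\in\mathsf{W}$, $r\in\mathsf{R}$;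 8. $\bigvee_{w\in\mathsf{W}}\mathsf{s}_w=\mathsf{s}_r$ for all $r\in\mathsf{R}$; 9. $\mathsf{rv}_{r_{assert}}>N$. Proofs. Let $\mathcal{A}$ be the set of $\mathcal{T}$-atoms of the formula, $\mathcal{L}_{\mathcal{A}}$ the set of literals over $\mathcal{A}$, and $(\cdot)^{\mathbb{B}}$ an injective map from $\mathcal{A}$ into a set $\mathcal{X}$ of propositional variables, lifted to literals and sets of literals. Clauses are finite sets of literals, read as disjunctions. Let $C_1,\dots,C_\alpha$ be the propositional abstractions of the clauses of the formula. A Fixed-Alphabet-DPLL($\mathcal{T}$) proof of its unsatisfiability is a finite sequence of clauses $C_1,\dots,C_\alpha,\dots,C_\beta=\Box$ (the empty clause), where each $C_k$ with $\alpha<k\le\beta$ is derived by one of two rules: (Res) $C_k$ is the propositional resolvent $(C_i\setminus\{\ell\})\cup(C_j\setminus\{\lnot\ell\})$ of two earlier clauses with $i\ne j$, $\ell\in C_i$, $\lnot\ell\in C_j$; ($\mathcal{T}$-learn) $C_k=L^{\mathbb{B}}$ for some $L\subseteq\mathcal{L}_{\mathcal{A}}$ with $\models_{\mathcal{T}}\bigvee_{t\in L}t$. The number of applications of $\mathcal{T}$-learn is the number of indices $k\in(\alpha,\beta]$ whose clause is derived by $\mathcal{T}$-learn. -}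

module Defs where

open import Level using (Level; 0ℓ) renaming (suc to lsuc; _⊔_ to _⊔ˡ_)
open import Data.Bool using (if_then_else_)
open import Data.Nat as ℕ using (ℕ; zero; suc; _^_; _∸_; _⊔_)
import Data.Nat.Properties as ℕₚ
open import Data.Nat.DivMod using (_mod_)
open import Data.Integer as ℤ using (ℤ; +_)
open import Data.Rational as ℚ using (ℚ; 0ℚ; ½; ∣_∣)
import Data.Rational.Properties as ℚₚ
open import Data.Rational.Solver using (module +-*-Solver)
open import Data.Fin as Fin using (Fin; toℕ)
open import Data.List using (List; []; _∷_; _++_; map; concatMap; filter; cartesianProduct; allFin; length; lookup)
open import Data.List.Membership.Propositional using (_∈_)
open import Data.List.Relation.Unary.All using (All)
open import Data.List.Relation.Unary.Any using (Any)
open import Data.Product using (Σ; ∃; _×_; _,_; proj₁; proj₂)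
open import Data.Sum using (_⊎_)
open import Data.Unit using (⊤)
open import Function.Base using (_∘_)
open import Function.Bundles using (_⇔_; Injection)
open import Relation.Binary.Bundles using (Setoid; StrictTotalOrder)
open import Relation.Binary.Definitions using (DecidableEquality)
open import Relation.Binary.PropositionalEquality as ≡ using (_≡_; _≢_; refl)
open import Relation.Nullary using (¬_; yes; no)
open import Relation.Nullary.Decidable using (¬?)
open import Relation.Unary using (Pred)

------------------------------------------------------------------------
-- Real numbers

-- Cauchy sequences of rationals; equality of reals is _≈ʳ_.
record ℝ : Set where
  constructor mkℝ
  field
    seq    : ℕ → ℚ
    cauchy : ∀ ε → 0ℚ ℚ.< ε →
             ∃ λ K → ∀ m n → K ℕ.≤ m → K ℕ.≤ n → ∣ seq m ℚ.- seq n ∣ ℚ.< ε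

open ℝ public

_≈ʳ_ : ℝ → ℝ → Set
x ≈ʳ y = ∀ ε → 0ℚ ℚ.< ε → ∃ λ K → ∀ n → K ℕ.≤ n → ∣ seq x n ℚ.- seq y n ∣ ℚ.< ε

_<ʳ_ : ℝ → ℝ → Set
x <ʳ y = ∃ λ ε → 0ℚ ℚ.< ε × ∃ λ K → ∀ n → K ℕ.≤ n → seq x n ℚ.+ ε ℚ.< seq y n

constʳ : ℚ → ℝ
constʳ q = mkℝ (λ _ → q) λ ε 0<ε → 0 , λ _ _ _ _ →
  ≡.subst (ℚ._< ε) (≡.sym (≡.cong ∣_∣ (ℚₚ.+-inverseʳ q))) 0<ε

_+ʳ_ : ℝ → ℝ → ℝ
x +ʳ y = mkℝ (λ n → seq x n ℚ.+ seq y n) λ ε 0<ε →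
  let 0<ε/2 = ≡.subst (ℚ._< ½ ℚ.* ε) (ℚₚ.*-zeroʳ ½) (ℚₚ.*-monoʳ-<-pos ½ 0<ε)
      K , p = cauchy x (½ ℚ.* ε) 0<ε/2
      L , q = cauchy y (½ ℚ.* ε) 0<ε/2
  in K ⊔ L , λ m n K⊔L≤m K⊔L≤n → begin-strict
    ∣ (seq x m ℚ.+ seq y m) ℚ.- (seq x n ℚ.+ seq y n) ∣
      ≡⟨ ≡.cong ∣_∣ (rearrange (seq x m) (seq y m) (seq x n) (seq y n)) ⟩
    ∣ (seq x m ℚ.- seq x n) ℚ.+ (seq y m ℚ.- seq y n) ∣
      ≤⟨ ℚₚ.∣p+q∣≤∣p∣+∣q∣ (seq x m ℚ.- seq x n) (seq y m ℚ.- seq y n) ⟩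
    ∣ seq x m ℚ.- seq x n ∣ ℚ.+ ∣ seq y m ℚ.- seq y n ∣
      <⟨ ℚₚ.+-mono-< (p m n (ℕₚ.m⊔n≤o⇒m≤o K L K⊔L≤m) (ℕₚ.m⊔n≤o⇒m≤o K L K⊔L≤n))
                     (q m n (ℕₚ.m⊔n≤o⇒n≤o K L K⊔L≤m) (ℕₚ.m⊔n≤o⇒n≤o K L K⊔L≤n)) ⟩
    ½ ℚ.* ε ℚ.+ ½ ℚ.* ε
      ≡⟨ ≡.sym (ℚₚ.*-distribʳ-+ ε ½ ½) ⟩
    (½ ℚ.+ ½) ℚ.* ε
      ≡⟨ ℚₚ.*-identityˡ ε ⟩
    ε ∎
  where
  open ℚₚ.≤-Reasoning
  rearrange : ∀ a b c d → (a ℚ.+ b) ℚ.- (c ℚ.+ d) ≡ (a ℚ.- c) ℚ.+ (b ℚ.- d)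
  rearrange = solve 4 (λ a b c d → (a :+ b) :- (c :+ d) := (a :- c) :+ (b :- d)) refl
    where open +-*-Solver

------------------------------------------------------------------------
-- Value theories

-- Only the part of each arithmetic signature that formulas use.
record ValueStructure : Set₁ where
  infix  4 _≈_ _<_
  infixl 6 _+_
  field
    Carrier : Set
    _≈_ _<_ : Carrier → Carrier → Set
    0# 1#   : Carrier
    _+_     : Carrier → Carrier → Carrier

  numeral : ℕ → Carrier
  numeral zero    = 0#
  numeral (suc k) = numeral k + 1#

data Signedness : Set where
  unsigned signed : Signedness

BV : ℕ → Set
BV w = Fin (2 ^ w)

wrap : ∀ w → ℕ → BV w
wrap w k = _mod_ k (2 ^ w) {{ℕₚ.m^n≢0 2 w}}

bvValue : Signedness → ∀ w → BV w → ℤ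
bvValue unsigned w x = + toℕ x
bvValue signed   w x = if toℕ x ℕ.<ᵇ 2 ^ (w ∸ 1) then + toℕ x else + toℕ x ℤ.- + (2 ^ w)

data ValueTheory : Set where
  bitVector               : Signedness → ℕ → ValueTheory
  presburgerℕ presburgerℤ : ValueTheory
  real                    : ValueTheory

⟦_⟧ⱽ : ValueTheory → ValueStructure
⟦ bitVector sg w ⟧ⱽ = record
  { Carrier = BV w ; _≈_ = _≡_ ; _<_ = λ x y → bvValue sg w x ℤ.< bvValue sg w y
  ; 0# = wrap w 0 ; 1# = wrap w 1 ; _+_ = λ x y → wrap w (toℕ x ℕ.+ toℕ y) }
⟦ presburgerℕ ⟧ⱽ = record
  { Carrier = ℕ ; _≈_ = _≡_ ; _<_ = ℕ._<_ ; 0# = 0 ; 1# = 1 ; _+_ = ℕ._+_ }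
⟦ presburgerℤ ⟧ⱽ = record
  { Carrier = ℤ ; _≈_ = _≡_ ; _<_ = ℤ._<_ ; 0# = + 0 ; 1# = + 1 ; _+_ = ℤ._+_ }
⟦ real ⟧ⱽ = record
  { Carrier = ℝ ; _≈_ = _≈ʳ_ ; _<_ = _<ʳ_ ; 0# = constʳ 0ℚ ; 1# = constʳ ℚ.1ℚ ; _+_ = _+ʳ_ }

-- The constants 0, …, m do not overflow: each denotes itself, so they are
-- distinct and in their usual order.
WideEnough : ValueTheory → ℕ → Set
WideEnough V@(bitVector sg w) m =
  ∀ k → k ℕ.≤ m → bvValue sg w (ValueStructure.numeral ⟦ V ⟧ⱽ k) ≡ + k
WideEnough _ _ = ⊤

------------------------------------------------------------------------
-- The combined theory T_C + T_V + T_S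

-- A theory is given by its models. The clock theory is any class of strict
-- total orders; the selection theory is uninterpreted, so that every setoid is
-- a model of it. The signatures are disjoint, so that a model of the
-- combination is a triple of models.
record Theory (ℓ : Level) : Set (lsuc ℓ ⊔ˡ lsuc 0ℓ) where
  field
    ClockModel  : Pred (StrictTotalOrder 0ℓ 0ℓ 0ℓ) ℓ
    valueTheory : ValueTheory

record Model {ℓ : Level} (T : Theory ℓ) : Set (ℓ ⊔ˡ lsuc 0ℓ) where
  open Theory T
  field
    clocks      : StrictTotalOrder 0ℓ 0ℓ 0ℓ
    clocksModel : ClockModel clocks
    selections  : Setoid 0ℓ 0ℓ

  values : ValueStructure
  values = ⟦ valueTheory ⟧ⱽ

AtLeast : ℕ → Setoid 0ℓ 0ℓ → Set
AtLeast n S = Injection (≡.setoid (Fin n)) S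

HasModelWith : ∀ {ℓ} → Theory ℓ → (nClocks nSelections : ℕ) → Set (ℓ ⊔ˡ lsuc 0ℓ)
HasModelWith T m n = Σ (Model T) λ M →
  AtLeast m (StrictTotalOrder.Eq.setoid (Model.clocks M)) × AtLeast n (Model.selections M)

------------------------------------------------------------------------
-- Syntax

data Sort : Set where
  clock value selection : Sort

data Term (V : Sort → Set) : Sort → Set where
  var : ∀ {σ} → V σ → Term V σ
  𝟘 𝟙 : Term V value
  _⊕_ : Term V value → Term V value → Term V value

num : ∀ {V} → ℕ → Term V value
num zero    = 𝟘
num (suc k) = num k ⊕ 𝟙

infix  6 _≺_ _≐_ _≻_
infixl 7 _⊕_

data Atom (V : Sort → Set) : Set where
  _≺_ : Term V clock → Term V clock → Atom V
  _≐_ : ∀ {σ} → Term V σ → Term V σ → Atom V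
  _≻_ : Term V value → Term V value → Atom V    -- arithmetic "greater than"

-- Identification of the atoms a ≐ b and b ≐ a.
data _∼_ {V : Sort → Set} : Atom V → Atom V → Set where
  same : ∀ {a} → a ∼ a
  swap : ∀ {σ} {t u : Term V σ} → (t ≐ u) ∼ (u ≐ t)

data Literal (A : Set) : Set where
  pos neg : A → Literal A

negate : ∀ {A} → Literal A → Literal A
negate (pos a) = neg a
negate (neg a) = pos a

atomOf : ∀ {A} → Literal A → A
atomOf (pos a) = a
atomOf (neg a) = a

mapLiteral : ∀ {A B} → (A → B) → Literal A → Literal B
mapLiteral f (pos a) = pos (f a)
mapLiteral f (neg a) = neg (f a)

-- Lists stand for finite sets: order and repetitions are irrelevant.
Clause : Set → Set
Clause A = List (Literal A)

Formula : (Sort → Set) → Set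
Formula V = List (Clause (Atom V))

infix 3 _⇒_
_⇒_ : ∀ {A} → List A → A → Clause A
as ⇒ b = map neg as ++ pos b ∷ []

atoms : ∀ {V} → Formula V → List (Atom V)
atoms = concatMap (map atomOf)

------------------------------------------------------------------------
-- Semantics

module Semantics {ℓ : Level} {T : Theory ℓ} (M : Model T) where
  open Model M
  private
    module C = StrictTotalOrder clocks
    module S = Setoid selections
    module V = ValueStructure values

  ⟦_⟧ˢ : Sort → Set
  ⟦ clock     ⟧ˢ = C.Carrier
  ⟦ value     ⟧ˢ = V.Carrier
  ⟦ selection ⟧ˢ = S.Carrier

  equal : ∀ σ → ⟦ σ ⟧ˢ → ⟦ σ ⟧ˢ → Set
  equal clock     = C._≈_
  equal value     = V._≈_
  equal selection = S._≈_

  module _ {Var : Sort → Set} (ρ : ∀ σ → Var σ → ⟦ σ ⟧ˢ) where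

    eval : ∀ {σ} → Term Var σ → ⟦ σ ⟧ˢ
    eval (var x) = ρ _ x
    eval 𝟘       = V.0#
    eval 𝟙       = V.1#
    eval (t ⊕ u) = eval t V.+ eval u

    ⟦_⟧ᴬ : Atom Var → Set
    ⟦ t ≺ u       ⟧ᴬ = eval t C.< eval u
    ⟦ _≐_ {σ} t u ⟧ᴬ = equal σ (eval t) (eval u)
    ⟦ t ≻ u       ⟧ᴬ = eval u V.< eval t

    ⟦_⟧ᴸ : Literal (Atom Var) → Set
    ⟦ pos a ⟧ᴸ = ⟦ a ⟧ᴬ
    ⟦ neg a ⟧ᴸ = ¬ ⟦ a ⟧ᴬ

-- Validity of the disjunction of L. The double negation makes the disjunction
-- classical; without it { a , ¬ a } would not be valid over the reals.
Valid : ∀ {ℓ} (T : Theory ℓ) {V : Sort → Set} → Clause (Atom V) → Set (ℓ ⊔ˡ lsuc 0ℓ)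
Valid T {V} L = (M : Model T) → let open Semantics M in
  (ρ : ∀ σ → V σ → ⟦ σ ⟧ˢ) → ¬ ¬ Any ⟦ ρ ⟧ᴸ L

------------------------------------------------------------------------
-- Fixed-Alphabet-DPLL(T)

-- An injective map on the atoms of φ, up to identification; its values on other
-- atoms are irrelevant.
IsAbstraction : ∀ {V} → Formula V → {X : Set} → (Atom V → X) → Set
IsAbstraction φ _ᴮ = ∀ a b → a ∈ atoms φ → b ∈ atoms φ → (a ᴮ ≡ b ᴮ) ⇔ (a ∼ b)

record IsResolvent {X : Set} (ℓ : Literal X) (C D E : Clause X) : Set where
  field
    pivotˡ : ℓ ∈ C
    pivotʳ : negate ℓ ∈ D
    result : ∀ m → m ∈ E ⇔ ((m ∈ C × m ≢ ℓ) ⊎ (m ∈ D × m ≢ negate ℓ))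

-- Proof sequences, indexed by the clauses obtained so far, the latest one first.
data Derivation {ℓ : Level} (T : Theory ℓ) {V : Sort → Set} (φ : Formula V)
                {X : Set} (_ᴮ : Atom V → X) : List (Clause X) → Set (ℓ ⊔ˡ lsuc 0ℓ) where
  start   : Derivation T φ _ᴮ (map (map (mapLiteral _ᴮ)) φ)
  res     : ∀ {Γ E} → Derivation T φ _ᴮ Γ →
            (i j : Fin (length Γ)) → i ≢ j →
            (l : Literal X) → IsResolvent l (lookup Γ i) (lookup Γ j) E →
            Derivation T φ _ᴮ (E ∷ Γ)
  T-learn : ∀ {Γ} → Derivation T φ _ᴮ Γ →
            (L : Clause (Atom V)) → All (λ l → atomOf l ∈ atoms φ) L → Valid T L →
            Derivation T φ _ᴮ (map (mapLiteral _ᴮ) L ∷ Γ)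

learnCount : ∀ {ℓ} {T : Theory ℓ} {V} {φ : Formula V} {X : Set} {abs : Atom V → X} {Γ} →
             Derivation T φ abs Γ → ℕ
learnCount start             = 0
learnCount (res d _ _ _ _ _) = learnCount d
learnCount (T-learn d _ _ _) = suc (learnCount d)

record UnsatProof {ℓ : Level} (T : Theory ℓ) {V : Sort → Set} (φ : Formula V)
                  {X : Set} (abs : Atom V → X) : Set (ℓ ⊔ˡ lsuc 0ℓ) where
  field
    {earlier}  : List (Clause X)
    derivation : Derivation T φ abs ([] ∷ earlier)

learnApplications : ∀ {ℓ} {T : Theory ℓ} {V} {φ : Formula V} {X : Set} {abs : Atom V → X} →
                    UnsatProof T φ abs → ℕ
learnApplications p = learnCount (UnsatProof.derivation p)

------------------------------------------------------------------------
-- The challenge problem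

data Read (N : ℕ) : Set where
  r       : Fin N → Read N
  rassert : Read N

data Write (N : ℕ) : Set where
  winit : Write N
  w     : Fin N → Write N

data Event (N : ℕ) : Set where
  read  : Read N → Event N
  write : Write N → Event N

_≟ᵂ_ : ∀ {N} → DecidableEquality (Write N)
winit ≟ᵂ winit = yes refl
winit ≟ᵂ w _   = no λ ()
w _   ≟ᵂ winit = no λ ()
w i   ≟ᵂ w j with i Fin.≟ j
... | yes refl = yes refl
... | no  i≢j  = no λ { refl → i≢j refl }

data Var (N : ℕ) : Sort → Set where
  cᵛ  : Event N → Var N clock
  sᵛ  : Event N → Var N selection
  rvᵛ : Read N → Var N value

reads : ∀ N → List (Read N)
reads N = rassert ∷ map r (allFin N)

writes : ∀ N → List (Write N)
writes N = winit ∷ map w (allFin N)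

module Encoding (N : ℕ) where

  cʳ : Read N → Term (Var N) clock
  cʳ e = var (cᵛ (read e))

  cʷ : Write N → Term (Var N) clock
  cʷ e = var (cᵛ (write e))

  sʳ : Read N → Term (Var N) selection
  sʳ e = var (sᵛ (read e))

  sʷ : Write N → Term (Var N) selection
  sʷ e = var (sᵛ (write e))

  rv : Read N → Term (Var N) value
  rv e = var (rvᵛ e)

  forEach : ∀ {A : Set} → List A → (A → Formula (Var N)) → Formula (Var N)
  forEach xs f = concatMap f xs

  threads : List (Fin N)
  threads = allFin N

  distinctWrites : List (Write N × Write N)
  distinctWrites =
    filter (λ p → ¬? (proj₁ p ≟ᵂ proj₂ p)) (cartesianProduct (writes N) (writes N))

  programOrder distinctness writeRead readFrom readInit readWrite fromRead someWrite violation
    : Formula (Var N)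

  programOrder =
    (pos (cʷ winit ≺ cʳ rassert) ∷ []) ∷
    forEach threads λ i →
      (pos (cʷ winit ≺ cʳ (r i)) ∷ []) ∷
      (pos (cʳ (r i) ≺ cʷ (w i)) ∷ []) ∷ []

  distinctness = forEach distinctWrites λ (a , b) →
    (neg (cʷ a ≐ cʷ b) ∷ []) ∷
    (neg (sʷ a ≐ sʷ b) ∷ []) ∷ []

  writeRead = forEach (writes N) λ a → forEach (reads N) λ b →
    (neg (cʷ a ≐ cʳ b) ∷ []) ∷ []

  readFrom = forEach (writes N) λ a → forEach (reads N) λ b →
    (sʷ a ≐ sʳ b ∷ [] ⇒ cʷ a ≺ cʳ b) ∷ []

  readInit = forEach (reads N) λ b →
    (sʷ winit ≐ sʳ b ∷ [] ⇒ num 0 ≐ rv b) ∷ []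

  readWrite = forEach threads λ i → forEach (reads N) λ b →
    (sʷ (w i) ≐ sʳ b ∷ [] ⇒ rv (r i) ⊕ 𝟙 ≐ rv b) ∷ []

  fromRead = forEach (writes N) λ a → forEach (writes N) λ a′ → forEach (reads N) λ b →
    (sʷ a ≐ sʳ b ∷ cʷ a ≺ cʷ a′ ∷ [] ⇒ cʳ b ≺ cʷ a′) ∷ []

  someWrite = forEach (reads N) λ b →
    map (λ a → pos (sʷ a ≐ sʳ b)) (writes N) ∷ []

  violation = (pos (rv rassert ≻ num N) ∷ []) ∷ []

φ³ : ∀ N → Formula (Var N)
φ³ N = programOrder ++ distinctness ++ writeRead ++ readFrom ++ readInit
    ++ readWrite ++ fromRead ++ someWrite ++ violation
  where open Encoding N

-- Every order π of the threads gives a propositional assignment that satisfies all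
-- clauses of φ³: it describes the execution in this order, except that the violation
-- is made true. Falsity of the empty clause propagates backwards through resolution
-- to some T-learned clause. A clause that is falsified by the assignments of π ≠ π′ is
-- not T-valid: take the clocks and selections of π and, from the first position where
-- π and π′ differ, increase its values by one. This changes, apart from the violation,
-- only an equation that holds for π and fails for π′, so the model satisfies all
-- literals on which both assignments agree. Hence the N! orders need distinct learned
-- clauses.

module Submission where

open import Defs
import Algebra.Properties.Group as GroupProperties
open import Data.Nat as ℕ using (ℕ; zero; suc; _+_; _*_; _≤_; _≥_; _!; s≤s; z≤n)
import Data.Nat.Properties as ℕₚ
open import Data.Fin as Fin using (Fin; zero; suc; toℕ; fromℕ<)
import Data.Fin.Properties as Finₚ
open import Data.Fin.Permutation using (Permutation′; insert; _⟨$⟩ʳ_; _⟨$⟩ˡ_)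
import Data.Fin.Permutation as Perm
import Data.Integer as ℤ
import Data.Integer.Properties as ℤₚ
open import Data.Rational as ℚ using (ℚ; 0ℚ; 1ℚ; ½)
import Data.Rational.Properties as ℚₚ
open import Data.List using (List; []; _∷_; map; concatMap; cartesianProduct; lookup; tabulate)
open import Data.List.Membership.Propositional using (_∈_; find; lose)
open import Data.List.Membership.Propositional.Properties
  using (∈-map⁺; ∈-map⁻; ∈-concatMap⁺; ∈-lookup; ∈-allFin)
open import Data.List.Properties using (length-tabulate)
open import Data.List.Relation.Binary.Permutation.Propositional.Properties using (↭-length)
import Data.List.Relation.Binary.Permutation.Setoid as ↭ₛ
import Data.List.Relation.Binary.Permutation.Setoid.Properties as ↭ₛₚ
open import Data.List.Relation.Unary.All as All using (All; []; _∷_)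
import Data.List.Relation.Unary.All.Properties as Allₚ
open import Data.List.Relation.Unary.AllPairs as AllPairs using (AllPairs; []; _∷_)
import Data.List.Relation.Unary.AllPairs.Properties as AllPairsₚ
open import Data.List.Relation.Unary.Any as Any using (Any; here; there)
import Data.List.Relation.Unary.Any.Properties as Anyₚ
import Data.List.Relation.Unary.Linked.Properties as Linked
open import Data.List.Sort.InsertionSort using (insertionSort)
import Data.List.Sort.Base
open import Data.Product using (Σ; ∃; _×_; _,_; proj₁; proj₂)
open import Data.Sum using (_⊎_; inj₁; inj₂; [_,_])
open import Data.Unit using (⊤)
open import Function using (_∘_; id)
open import Function.Bundles using (Injection; Equivalence)
open import Function.Properties.Inverse using (↔⇒↣)
open import Level using (0ℓ)
open import Relation.Binary.Bundles using (Setoid; StrictTotalOrder; DecTotalOrder)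
open import Relation.Binary.Definitions using (tri<; tri≈; tri>)
open import Relation.Binary.PropositionalEquality
  using (_≡_; _≢_; refl; sym; trans; cong; cong₂; subst; subst₂; module ≡-Reasoning)
import Relation.Binary.Properties.StrictTotalOrder as STOₚ
open import Relation.Nullary using (¬_; yes; no; contradiction)
open import Relation.Nullary.Decidable using (¬?; toWitness; decidable-stable)
open import Relation.Unary using (Pred; Decidable)

-- Counting T-learn steps

infix 4 _⊨_
_⊨_ : {A : Set} → Pred A 0ℓ → Literal A → Set
P ⊨ pos a = P a
P ⊨ neg a = ¬ P a

module Refutation {ℓ} {T : Theory ℓ} {V : Sort → Set} {φ : Formula V} {X : Set} {abs : Atom V → X}
  (abstraction : IsAbstraction φ abs) where

  InAlphabet : Literal (Atom V) → Set
  InAlphabet l = atomOf l ∈ atoms φ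

  liftAbs : Literal (Atom V) → Literal X
  liftAbs = mapLiteral abs

  Abstract : Literal X → Set
  Abstract m = ∃ λ l → InAlphabet l × m ≡ liftAbs l

  inAlphabet : ∀ {C l} → C ∈ φ → l ∈ C → InAlphabet l
  inAlphabet C∈φ l∈C = ∈-concatMap⁺ (map atomOf) (Any.map (λ { refl → ∈-map⁺ atomOf l∈C }) C∈φ)

  -- The rule `res` allows any pivot over `X`. But a pivot occurs in an earlier clause, so it is the
  -- abstraction of a literal over the atoms of `φ`, and an assignment to these atoms gives it a
  -- truth value.
  derived-abstract : ∀ {Γ} → Derivation T φ abs Γ → All (All Abstract) Γ
  derived-abstract start =
    Allₚ.map⁺ (All.tabulate λ C∈φ → Allₚ.map⁺ (All.tabulate λ l∈C → _ , inAlphabet C∈φ l∈C , refl))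
  derived-abstract (res {Γ} d i j _ l R) = All.tabulate resolvent ∷ ih
    where
    ih = derived-abstract d
    resolvent : ∀ {m} → m ∈ _ → Abstract m
    resolvent {m} m∈E with Equivalence.to (IsResolvent.result R m) m∈E
    ... | inj₁ (m∈C , _) = All.lookup (All.lookup ih (∈-lookup i)) m∈C
    ... | inj₂ (m∈D , _) = All.lookup (All.lookup ih (∈-lookup j)) m∈D
  derived-abstract (T-learn d L L⊆φ _) =
    Allₚ.map⁺ (All.map (λ l∈φ → _ , l∈φ , refl) L⊆φ) ∷ derived-abstract d

  learned : ∀ {Γ} (d : Derivation T φ abs Γ) → Fin (learnCount d) → Clause (Atom V)
  learned (res d _ _ _ _ _) n       = learned d n
  learned (T-learn d L _ _) zero    = L
  learned (T-learn d L _ _) (suc n) = learned d n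

  learned-alphabet : ∀ {Γ} (d : Derivation T φ abs Γ) n → All InAlphabet (learned d n)
  learned-alphabet (res d _ _ _ _ _)   n       = learned-alphabet d n
  learned-alphabet (T-learn d _ L⊆φ _) zero    = L⊆φ
  learned-alphabet (T-learn d _ _ _)   (suc n) = learned-alphabet d n

  learned-valid : ∀ {Γ} (d : Derivation T φ abs Γ) n → Valid T (learned d n)
  learned-valid (res d _ _ _ _ _) n       = learned-valid d n
  learned-valid (T-learn d _ _ v) zero    = v
  learned-valid (T-learn d _ _ _) (suc n) = learned-valid d n

  module _ (P : Pred (Atom V) 0ℓ) (P? : Decidable P) (P-resp-∼ : ∀ {a b} → a ∼ b → P a → P b) where

    -- The assignment `P` lives on atoms rather than on `X`, so falsity of an abstract clause is
    -- stated through all alphabet literals that are mapped into it.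
    Falsifies : Clause X → Set
    Falsifies C = ∀ l → InAlphabet l → liftAbs l ∈ C → ¬ P ⊨ l

    ⊨? : Decidable (P ⊨_)
    ⊨? (pos a) = P? a
    ⊨? (neg a) = ¬? (P? a)

    ∼-sym : ∀ {a b : Atom V} → a ∼ b → b ∼ a
    ∼-sym same = same
    ∼-sym swap = swap

    -- By injectivity of the abstraction the two atoms are equal up to `_∼_`, so `P` gives them the
    -- same truth value.
    complementary : ∀ l m → InAlphabet l → InAlphabet m →
                    liftAbs m ≡ negate (liftAbs l) → P ⊨ l → ¬ P ⊨ m
    complementary l m l∈φ m∈φ eq l-true m-true with l | m
    ... | pos a | neg b = m-true (P-resp-∼ (∼-sym b∼a) l-true)
      where b∼a = Equivalence.to (abstraction b a m∈φ l∈φ) (neg-injective eq)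
              where neg-injective : ∀ {x y : X} → neg x ≡ neg y → x ≡ y
                    neg-injective refl = refl
    ... | neg a | pos b = l-true (P-resp-∼ b∼a m-true)
      where b∼a = Equivalence.to (abstraction b a m∈φ l∈φ) (pos-injective eq)
              where pos-injective : ∀ {x y : X} → pos x ≡ pos y → x ≡ y
                    pos-injective refl = refl
    ... | pos a | pos b = contradiction eq λ ()
    ... | neg a | neg b = contradiction eq λ ()

    -- `P` makes the pivot literal of one premise false, and all other literals of that premise
    -- occur in the resolvent.
    resolvent-falsified : ∀ {l C D E} → Abstract l → IsResolvent l C D E →
                          Falsifies E → Falsifies C ⊎ Falsifies D
    resolvent-falsified {C = C} {D} (l , l∈φ , refl) R E-false with ⊨? l
    -- `m` may differ from `l` by a swapped equation, so the clash between them goes through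
    -- `complementary`.
    ... | no  l-false = inj₁ λ m m∈φ m∈C m-true →
      E-false m m∈φ (Equivalence.from (IsResolvent.result R _)
        (inj₁ (m∈C , λ m≡l → complementary (negate l) m (negate-alphabet l l∈φ) m∈φ
          (trans m≡l (sym (negate-negate l))) (negate-true l l-false) m-true))) m-true
      where
      negate-alphabet : ∀ l → InAlphabet l → InAlphabet (negate l)
      negate-alphabet (pos _) = id
      negate-alphabet (neg _) = id
      negate-negate : ∀ l → negate (liftAbs (negate l)) ≡ liftAbs l
      negate-negate (pos _) = refl
      negate-negate (neg _) = refl
      negate-true : ∀ l → ¬ P ⊨ l → P ⊨ negate l
      negate-true (pos _) ¬a  = ¬a
      negate-true (neg a) ¬¬a = decidable-stable (P? a) ¬¬a
    ... | yes l-true = inj₂ λ m m∈φ m∈D m-true →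
      E-false m m∈φ (Equivalence.from (IsResolvent.result R _)
        (inj₂ (m∈D , λ m≡¬l → complementary l m l∈φ m∈φ m≡¬l l-true m-true))) m-true

    -- The search cannot end at an input clause, as `P` satisfies all of them. From a false
    -- resolvent it moves to a false premise, so it stops at a learned clause.
    falsified-learned : All (Any (P ⊨_)) φ →
                        ∀ {Γ C} (d : Derivation T φ abs Γ) → C ∈ Γ → Falsifies C →
                        ∃ λ n → All (λ l → ¬ P ⊨ l) (learned d n)
    falsified-learned sat start C∈Γ C-false with ∈-map⁻ _ C∈Γ
    ... | D , D∈φ , refl with find (All.lookup sat D∈φ)
    ... | l , l∈D , l-true =
      contradiction l-true (C-false l (inAlphabet D∈φ l∈D) (∈-map⁺ _ l∈D))
    falsified-learned sat (res d _ _ _ _ _) (there C∈Γ) C-false = falsified-learned sat d C∈Γ C-false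
    falsified-learned sat (res d i j _ l R) (here refl) E-false
      with resolvent-falsified
             (All.lookup (All.lookup (derived-abstract d) (∈-lookup i)) (IsResolvent.pivotˡ R)) R E-false
    ... | inj₁ C-false = falsified-learned sat d (∈-lookup i) C-false
    ... | inj₂ D-false = falsified-learned sat d (∈-lookup j) D-false
    falsified-learned sat (T-learn d L L⊆φ _) (here refl) L-false =
      zero , All.tabulate λ l∈L → L-false _ (All.lookup L⊆φ l∈L) (∈-map⁺ _ l∈L)
    falsified-learned sat (T-learn d _ _ _) (there C∈Γ) C-false
      with falsified-learned sat d C∈Γ C-false
    ... | n , L-false = suc n , L-false

  -- The literals on which they agree have a common model.
  NonInterfering : Pred (Atom V) 0ℓ → Pred (Atom V) 0ℓ → Set _
  NonInterfering P Q = Σ (Model T) λ M → let open Semantics M in Σ (∀ σ → V σ → ⟦ σ ⟧ˢ) λ ρ →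
    ∀ {a} → a ∈ atoms φ → (P a → Q a → ⟦ ρ ⟧ᴬ a) × (¬ P a → ¬ Q a → ¬ ⟦ ρ ⟧ᴬ a)

  -- On the atom of a literal that is false under both, the two assignments agree, and so does the
  -- common model. Hence this model falsifies every literal of `L`.
  commonly-falsified-invalid : ∀ {P Q} → Decidable P → Decidable Q → NonInterfering P Q →
                               ∀ {L} → All InAlphabet L → All (λ l → ¬ P ⊨ l) L →
                               All (λ l → ¬ Q ⊨ l) L → ¬ Valid T L
  commonly-falsified-invalid P? Q? (M , ρ , agree) L⊆φ P-false Q-false valid = valid M ρ λ true →
    let l , l∈L , l-true = find true
    in false l (All.lookup L⊆φ l∈L) (All.lookup P-false l∈L) (All.lookup Q-false l∈L) l-true
    where
    open Semantics M
    false : ∀ l → InAlphabet l → ¬ _ ⊨ l → ¬ _ ⊨ l → ¬ ⟦ ρ ⟧ᴸ l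
    false (pos a) a∈φ ¬Pa ¬Qa a-true = proj₂ (agree a∈φ) ¬Pa ¬Qa a-true
    false (neg a) a∈φ ¬¬Pa ¬¬Qa a-false =
      a-false (proj₁ (agree a∈φ) (decidable-stable (P? a) ¬¬Pa) (decidable-stable (Q? a) ¬¬Qa))

  nonInterfering⇒≤ : ∀ {k} (P : Fin k → Pred (Atom V) 0ℓ) → (∀ i → Decidable (P i)) →
                     (∀ i {a b} → a ∼ b → P i a → P i b) →
                     (∀ i → All (Any (P i ⊨_)) φ) →
                     (∀ i j → i ≢ j → NonInterfering (P i) (P j)) →
                     (p : UnsatProof T φ abs) → k ≤ learnApplications p
  nonInterfering⇒≤ P P? P-resp-∼ sat independent p = Finₚ.injective⇒≤ {f = proj₁ ∘ step} step-injective
    where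
    d = UnsatProof.derivation p
    step : ∀ i → ∃ λ n → All (λ l → ¬ P i ⊨ l) (learned d n)
    -- The search starts from the empty clause, which is vacuously false.
    step i = falsified-learned (P i) (P? i) (P-resp-∼ i) (sat i) d (here refl) (λ _ _ ())
    step-injective : ∀ {i j} → proj₁ (step i) ≡ proj₁ (step j) → i ≡ j
    step-injective {i} {j} eq = decidable-stable (i Finₚ.≟ j) λ i≢j →
      commonly-falsified-invalid (P? i) (P? j) (independent i j i≢j)
        (learned-alphabet d (proj₁ (step j)))
        (subst (λ n → All (λ l → ¬ P i ⊨ l) (learned d n)) eq (proj₂ (step i)))
        (proj₂ (step j)) (learned-valid d (proj₁ (step j)))

-- Enumerating permutations

-- The index splits into the image `i` of `zero` and an index for a permutation of the rest.
permutations : ∀ n → Fin (n !) → Permutation′ n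
permutations zero    _ = Perm.id
permutations (suc n) k = let i , j = Fin.remQuot (n !) k in insert zero i (permutations n j)

-- The image of `zero` recovers `i`; then `punchIn i` can be cancelled from the other images.
permutations-injective : ∀ n {k l} → permutations n k Perm.≈ permutations n l → k ≡ l
permutations-injective zero    {zero} {zero} _ = refl
permutations-injective (suc n) {k} {l} eq = begin
  k                                            ≡⟨ Finₚ.combine-remQuot {suc n} (n !) k ⟨
  Fin.combine (proj₁ (rq k)) (proj₂ (rq k))
    ≡⟨ cong₂ Fin.combine (eq zero) (permutations-injective n tail) ⟩
  Fin.combine (proj₁ (rq l)) (proj₂ (rq l))    ≡⟨ Finₚ.combine-remQuot {suc n} (n !) l ⟩
  l                                            ∎
  where
  open ≡-Reasoning
  rq = Fin.remQuot {suc n} (n !)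
  tail : ∀ x → permutations n (proj₂ (rq k)) ⟨$⟩ʳ x ≡ permutations n (proj₂ (rq l)) ⟨$⟩ʳ x
  tail x = Finₚ.punchIn-injective (proj₁ (rq k)) _ _ (begin
    Fin.punchIn (proj₁ (rq k)) (permutations n (proj₂ (rq k)) ⟨$⟩ʳ x)
      ≡⟨ eq (suc x) ⟩
    Fin.punchIn (proj₁ (rq l)) (permutations n (proj₂ (rq l)) ⟨$⟩ʳ x)
      ≡⟨ cong (λ i → Fin.punchIn i (permutations n (proj₂ (rq l)) ⟨$⟩ʳ x)) (eq zero) ⟨
    Fin.punchIn (proj₁ (rq k)) (permutations n (proj₂ (rq l)) ⟨$⟩ʳ x) ∎)

-- Chains in strict total orders

AllPairs-lookup : ∀ {A : Set} {R : A → A → Set} {xs} → AllPairs R xs →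
                  ∀ {i j} → i Fin.< j → R (lookup xs i) (lookup xs j)
AllPairs-lookup (x∼xs ∷ _) {zero}  {suc j} _         = All.lookup x∼xs (∈-lookup j)
AllPairs-lookup (_ ∷ pxs)  {suc i} {suc j} (s≤s i<j) = AllPairs-lookup pxs i<j

-- The model supplies distinct clocks, while an execution needs ordered ones. Sorting gives a weakly
-- increasing list, and distinctness survives the reordering, so the order is strict.
chain : ∀ {n} (O : StrictTotalOrder 0ℓ 0ℓ 0ℓ) → let open StrictTotalOrder O in
        AtLeast n Eq.setoid → ∃ λ (f : Fin n → Carrier) → ∀ {i j} → i Fin.< j → f i < f j
chain {n} O elements = subst (λ m → ∃ λ (f : Fin m → Carrier) → ∀ {i j} → i Fin.< j → f i < f j)
    (trans (↭-length (sort-↭ xs)) (length-tabulate (Injection.to elements)))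
    (lookup (sort xs) , AllPairs-lookup increasing)
  where
  open StrictTotalOrder O using (Carrier; _≈_; _<_; module Eq)
  open DecTotalOrder (STOₚ.decTotalOrder O) using () renaming (trans to ≤-trans)
  open Data.List.Sort.Base.SortingAlgorithm (insertionSort (STOₚ.decTotalOrder O))
  xs : List Carrier
  xs = tabulate (Injection.to elements)
  unique : AllPairs (λ x y → ¬ x ≈ y) (sort xs)
  unique = ↭ₛₚ.Unique-resp-↭ Eq.setoid (↭ₛ.↭-sym Eq.setoid (sort-↭ₛ xs))
    (AllPairsₚ.tabulate⁺ λ i≢j → i≢j ∘ Injection.injective elements)
  increasing : AllPairs _<_ (sort xs)
  increasing = AllPairs.zipWith (λ (x≤y , x≉y) → [ id , (λ x≈y → contradiction x≈y x≉y) ] x≤y)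
    (Linked.Linked⇒AllPairs ≤-trans (sort-↗ xs) , unique)

-- Numerals

private
  module Num (V : ValueTheory) = ValueStructure ⟦ V ⟧ⱽ

  numeral-ℕ : ∀ n → Num.numeral presburgerℕ n ≡ n
  numeral-ℕ zero    = refl
  numeral-ℕ (suc n) = trans (cong (ℕ._+ 1) (numeral-ℕ n)) (ℕₚ.+-comm n 1)

  numeral-ℤ : ∀ n → Num.numeral presburgerℤ n ≡ ℤ.+ n
  numeral-ℤ zero    = refl
  numeral-ℤ (suc n) = trans (cong (ℤ._+ ℤ.+ 1) (numeral-ℤ n)) (cong ℤ.+_ (ℕₚ.+-comm n 1))

  numeral-ℚ : ℕ → ℚ
  numeral-ℚ zero    = 0ℚ
  numeral-ℚ (suc n) = numeral-ℚ n ℚ.+ 1ℚ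

  seq-numeral : ∀ k n → seq (Num.numeral real k) n ≡ numeral-ℚ k
  seq-numeral zero    n = refl
  seq-numeral (suc k) n = cong (ℚ._+ 1ℚ) (seq-numeral k n)

  ∣p-q∣≡∣q-p∣ : ∀ p q → ℚ.∣ p ℚ.- q ∣ ≡ ℚ.∣ q ℚ.- p ∣
  ∣p-q∣≡∣q-p∣ p q = trans (sym (ℚₚ.∣-p∣≡∣p∣ (p ℚ.- q))) (cong ℚ.∣_∣ (⁻¹-anti-homo-// p q))
    where open GroupProperties ℚₚ.+-0-group

  x≤x+1 : ∀ x → x ℚ.≤ x ℚ.+ 1ℚ
  x≤x+1 x = subst (ℚ._≤ x ℚ.+ 1ℚ) (ℚₚ.+-identityʳ x) (ℚₚ.+-monoʳ-≤ x (ℚₚ.nonNegative⁻¹ 1ℚ))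

  numeral-ℚ-mono : ∀ {m n} → m ℕ.≤′ n → numeral-ℚ m ℚ.≤ numeral-ℚ n
  numeral-ℚ-mono (ℕ.≤′-reflexive refl)     = ℚₚ.≤-refl
  numeral-ℚ-mono (ℕ.≤′-step m≤n) = ℚₚ.≤-trans (numeral-ℚ-mono m≤n) (x≤x+1 _)

  -- Consecutive numerals are 1 apart, so tolerance 1 in `_≈ʳ_` already tells different numerals
  -- apart.
  real-numeral-distinct : ∀ {m n} → m ℕ.< n → ¬ ℚ.∣ numeral-ℚ n ℚ.- numeral-ℚ m ∣ ℚ.< 1ℚ
  real-numeral-distinct {m} {n} m<n close = ℚₚ.<-irrefl refl (ℚₚ.<-≤-trans close (begin
    1ℚ                                      ≡⟨ ℚₚ.+-identityˡ 1ℚ ⟨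
    0ℚ ℚ.+ 1ℚ                               ≡⟨ cong (ℚ._+ 1ℚ) (ℚₚ.+-inverseˡ (numeral-ℚ m)) ⟨
    (ℚ.- numeral-ℚ m ℚ.+ numeral-ℚ m) ℚ.+ 1ℚ ≡⟨ ℚₚ.+-assoc (ℚ.- numeral-ℚ m) (numeral-ℚ m) 1ℚ ⟩
    ℚ.- numeral-ℚ m ℚ.+ numeral-ℚ (suc m)
      ≤⟨ ℚₚ.+-monoʳ-≤ (ℚ.- numeral-ℚ m) (numeral-ℚ-mono (ℕₚ.≤⇒≤′ m<n)) ⟩
    ℚ.- numeral-ℚ m ℚ.+ numeral-ℚ n         ≡⟨ ℚₚ.+-comm (ℚ.- numeral-ℚ m) (numeral-ℚ n) ⟩
    numeral-ℚ n ℚ.- numeral-ℚ m             ≤⟨ p≤∣p∣ (numeral-ℚ n ℚ.- numeral-ℚ m) ⟩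
    ℚ.∣ numeral-ℚ n ℚ.- numeral-ℚ m ∣       ∎))
    where
    open ℚₚ.≤-Reasoning
    p≤∣p∣ : ∀ p → p ℚ.≤ ℚ.∣ p ∣
    p≤∣p∣ p with ℚₚ.≤-total 0ℚ p
    ... | inj₁ 0≤p = ℚₚ.≤-reflexive (sym (ℚₚ.0≤p⇒∣p∣≡p 0≤p))
    ... | inj₂ p≤0 = ℚₚ.≤-trans p≤0 (ℚₚ.0≤∣p∣ p)

≈-refl : ∀ V {x : Num.Carrier V} → Num._≈_ V x x
≈-refl (bitVector _ _) = refl
≈-refl presburgerℕ = refl
≈-refl presburgerℤ = refl
≈-refl real {x} ε 0<ε = 0 , λ n _ →
  subst (ℚ._< ε) (sym (cong ℚ.∣_∣ (ℚₚ.+-inverseʳ (seq x n)))) 0<ε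

numeral-injective : ∀ V {m a b} → WideEnough V m → a ≤ m → b ≤ m →
                    Num._≈_ V (Num.numeral V a) (Num.numeral V b) → a ≡ b
numeral-injective (bitVector sg width) wide a≤m b≤m eq =
  ℤₚ.+-injective (trans (sym (wide _ a≤m)) (trans (cong (bvValue sg width) eq) (wide _ b≤m)))
numeral-injective presburgerℕ {a = a} {b} _ _ _ eq = trans (sym (numeral-ℕ a)) (trans eq (numeral-ℕ b))
numeral-injective presburgerℤ {a = a} {b} _ _ _ eq =
  ℤₚ.+-injective (trans (sym (numeral-ℤ a)) (trans eq (numeral-ℤ b)))
numeral-injective real {a = a} {b} _ _ _ eq with eq 1ℚ (ℚₚ.positive⁻¹ 1ℚ)
... | K , close
  with subst₂ (λ x y → ℚ.∣ x ℚ.- y ∣ ℚ.< 1ℚ) (seq-numeral a K) (seq-numeral b K) (close K ℕₚ.≤-refl)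
... | a-b<1 with ℕₚ.<-cmp a b
... | tri≈ _ a≡b _ = a≡b
... | tri> _ _ b<a = contradiction a-b<1 (real-numeral-distinct b<a)
... | tri< a<b _ _ = contradiction
  (subst (ℚ._< 1ℚ) (∣p-q∣≡∣q-p∣ (numeral-ℚ a) (numeral-ℚ b)) a-b<1) (real-numeral-distinct a<b)

numeral-<-suc : ∀ V {m n} → WideEnough V m → suc n ≤ m →
                Num._<_ V (Num.numeral V n) (Num.numeral V (suc n))
numeral-<-suc (bitVector _ _) {n = n} wide n<m =
  subst₂ ℤ._<_ (sym (wide n (ℕₚ.<⇒≤ n<m))) (sym (wide (suc n) n<m)) (ℤ.+<+ ℕₚ.≤-refl)
numeral-<-suc presburgerℕ {n = n} _ _ =
  subst₂ ℕ._<_ (sym (numeral-ℕ n)) (sym (numeral-ℕ (suc n))) ℕₚ.≤-refl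
numeral-<-suc presburgerℤ {n = n} _ _ =
  subst₂ ℤ._<_ (sym (numeral-ℤ n)) (sym (numeral-ℤ (suc n))) (ℤ.+<+ ℕₚ.≤-refl)
numeral-<-suc real {n = n} _ _ =
  -- The numerals differ by 1, and `_<ʳ_` asks for a positive gap strictly below the difference.
  ½ , ℚₚ.positive⁻¹ ½ , 0 ,
  λ i _ → ℚₚ.+-monoʳ-< (seq (Num.numeral real n) i) (toWitness {a? = ½ ℚₚ.<? 1ℚ} _)

-- Clauses and atoms of the encoding

module _ {A B : Set} {P : Pred B 0ℓ} {f : A → List B} where

  All-concatMap⁺ : ∀ {xs} → All (All P ∘ f) xs → All P (concatMap f xs)
  All-concatMap⁺ = Allₚ.concat⁺ ∘ Allₚ.map⁺

  All-concatMap-universal : (∀ x → All P (f x)) → ∀ xs → All P (concatMap f xs)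
  All-concatMap-universal p xs = All-concatMap⁺ (All.universal p xs)

module _ {N : ℕ} where

  open Encoding N

  -- Sorts the clauses by shape, so that satisfaction is shown by case analysis instead of a walk
  -- through nested lists.
  data EncodingClause : Clause (Atom (Var N)) → Set where
    init-before-assert : EncodingClause (pos (cʷ winit ≺ cʳ rassert) ∷ [])
    init-before-read   : ∀ i → EncodingClause (pos (cʷ winit ≺ cʳ (r i)) ∷ [])
    read-before-write  : ∀ i → EncodingClause (pos (cʳ (r i) ≺ cʷ (w i)) ∷ [])
    clocks-distinct    : ∀ {a b} → a ≢ b → EncodingClause (neg (cʷ a ≐ cʷ b) ∷ [])
    writes-distinct    : ∀ {a b} → a ≢ b → EncodingClause (neg (sʷ a ≐ sʷ b) ∷ [])
    write≢read         : ∀ a b → EncodingClause (neg (cʷ a ≐ cʳ b) ∷ [])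
    read-from          : ∀ a b → EncodingClause (sʷ a ≐ sʳ b ∷ [] ⇒ cʷ a ≺ cʳ b)
    read-init          : ∀ b → EncodingClause (sʷ winit ≐ sʳ b ∷ [] ⇒ num 0 ≐ rv b)
    read-write         : ∀ i b → EncodingClause (sʷ (w i) ≐ sʳ b ∷ [] ⇒ rv (r i) ⊕ 𝟙 ≐ rv b)
    from-read          : ∀ a a′ b →
                         EncodingClause (sʷ a ≐ sʳ b ∷ cʷ a ≺ cʷ a′ ∷ [] ⇒ cʳ b ≺ cʷ a′)
    some-write         : ∀ b → EncodingClause (map (λ a → pos (sʷ a ≐ sʳ b)) (writes N))
    violated           : EncodingClause (pos (rv rassert ≻ num N) ∷ [])

  φ³-clauses : All EncodingClause (φ³ N)
  φ³-clauses =
    Allₚ.++⁺ {xs = programOrder}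
      (init-before-assert ∷
        universal (λ i → init-before-read i ∷ read-before-write i ∷ []) threads) (
    Allₚ.++⁺ {xs = distinctness}
      (All-concatMap⁺ (All.map (λ a≢b → clocks-distinct a≢b ∷ writes-distinct a≢b ∷ [])
        (Allₚ.all-filter (λ p → ¬? (proj₁ p ≟ᵂ proj₂ p)) (cartesianProduct (writes N) (writes N))))) (
    Allₚ.++⁺ {xs = writeRead}
      (universal (λ a → universal (λ b → write≢read a b ∷ []) (reads N)) (writes N)) (
    Allₚ.++⁺ {xs = readFrom}
      (universal (λ a → universal (λ b → read-from a b ∷ []) (reads N)) (writes N)) (
    Allₚ.++⁺ {xs = readInit}
      (universal (λ b → read-init b ∷ []) (reads N)) (
    Allₚ.++⁺ {xs = readWrite}
      (universal (λ i → universal (λ b → read-write i b ∷ []) (reads N)) threads) (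
    Allₚ.++⁺ {xs = fromRead}
      (universal (λ a → universal (λ a′ → universal (λ b → from-read a a′ b ∷ [])
        (reads N)) (writes N)) (writes N)) (
    Allₚ.++⁺ {xs = someWrite}
      (universal (λ b → some-write b ∷ []) (reads N))
      (violated ∷ []))))))))
    where
    universal : ∀ {A : Set} {f : A → Formula (Var N)} →
                (∀ x → All EncodingClause (f x)) → ∀ xs → All EncodingClause (concatMap f xs)
    universal = All-concatMap-universal

  data EncodingAtom : Atom (Var N) → Set where
    before      : ∀ e e′ → EncodingAtom (var (cᵛ e) ≺ var (cᵛ e′))
    same-clock  : ∀ e e′ → EncodingAtom (var (cᵛ e) ≐ var (cᵛ e′))
    same-select : ∀ e e′ → EncodingAtom (var (sᵛ e) ≐ var (sᵛ e′))
    initial     : ∀ b → EncodingAtom (num 0 ≐ rv b)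
    increment   : ∀ i b → EncodingAtom (rv (r i) ⊕ 𝟙 ≐ rv b)
    assertion-violated  : EncodingAtom (rv rassert ≻ num N)

  clause-atoms : ∀ {C} → EncodingClause C → All (EncodingAtom ∘ atomOf) C
  clause-atoms init-before-assert     = before _ _ ∷ []
  clause-atoms (init-before-read i)   = before _ _ ∷ []
  clause-atoms (read-before-write i)  = before _ _ ∷ []
  clause-atoms (clocks-distinct _)    = same-clock _ _ ∷ []
  clause-atoms (writes-distinct _)    = same-select _ _ ∷ []
  clause-atoms (write≢read a b)       = same-clock _ _ ∷ []
  clause-atoms (read-from a b)        = same-select _ _ ∷ before _ _ ∷ []
  clause-atoms (read-init b)          = same-select _ _ ∷ initial b ∷ []
  clause-atoms (read-write i b)       = same-select _ _ ∷ increment i b ∷ []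
  clause-atoms (from-read a a′ b)     = same-select _ _ ∷ before _ _ ∷ before _ _ ∷ []
  clause-atoms (some-write b)         = Allₚ.map⁺ (All.universal (λ a → same-select _ _) (writes N))
  clause-atoms violated               = assertion-violated ∷ []

  φ³-atoms : All EncodingAtom (atoms (φ³ N))
  φ³-atoms = All-concatMap⁺ (All.map (Allₚ.map⁺ ∘ clause-atoms) φ³-clauses)

-- Executions of the program

1+2m<2*[1+m] : ∀ m → suc (2 * m) ℕ.< 2 * suc m
1+2m<2*[1+m] m = ℕₚ.≤-reflexive (sym (ℕₚ.*-suc 2 m))

-- The execution that runs the threads in the order π 0, …, π (N - 1) followed by
-- the assertion. Reads and writes alternate: the read at place p sees the write
-- in slot p, which precedes it immediately and has stored the value p.
module Execution {N : ℕ} (π : Permutation′ N) where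

  open Encoding N

  place : Read N → ℕ
  place (r i)   = toℕ (π ⟨$⟩ˡ i)
  place rassert = N

  slot : Write N → ℕ
  slot winit = 0
  slot (w i) = suc (place (r i))

  time : Event N → ℕ
  time (read b)  = suc (2 * place b)
  time (write a) = 2 * slot a

  source : Event N → ℕ
  source (read b)  = place b
  source (write a) = slot a

  place≤ : ∀ b → place b ≤ N
  place≤ (r i)   = ℕₚ.<⇒≤ (Finₚ.toℕ<n (π ⟨$⟩ˡ i))
  place≤ rassert = ℕₚ.≤-refl

  slot≤ : ∀ a → slot a ≤ N
  slot≤ winit = z≤n
  slot≤ (w i) = Finₚ.toℕ<n (π ⟨$⟩ˡ i)

  -- Writes take the even times 0 to 2N and reads the odd times 1 to 2N + 1, so the bound is the
  -- number of clocks assumed of the model.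
  time< : ∀ e → time e ℕ.< 2 * N + 2
  time< e = subst (time e ℕ.<_) (trans (ℕₚ.*-suc 2 N) (ℕₚ.+-comm 2 (2 * N))) (bound e)
    where
    bound : ∀ e → time e ℕ.< 2 * suc N
    bound (read b)  = ℕₚ.<-≤-trans (1+2m<2*[1+m] (place b)) (ℕₚ.*-monoʳ-≤ 2 (s≤s (place≤ b)))
    bound (write a) = ℕₚ.*-monoʳ-< 2 (s≤s (slot≤ a))

  source< : ∀ e → source e ℕ.< N + 1
  source< e = subst (source e ℕ.<_) (ℕₚ.+-comm 1 N) (s≤s (bound e))
    where
    bound : ∀ e → source e ≤ N
    bound (read b)  = place≤ b
    bound (write a) = slot≤ a

  slot-injective : ∀ {a b} → slot a ≡ slot b → a ≡ b
  slot-injective {winit} {winit} _  = refl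
  slot-injective {w i}   {w j}   eq = cong w (Injection.injective (↔⇒↣ (Perm.flip π))
    (Finₚ.toℕ-injective (ℕₚ.suc-injective eq)))

  -- Slot 0 belongs to the initialization and slot `suc p` to the thread in position `p`. This
  -- provides every read with a source.
  slot-surjective : ∀ {p} → p ≤ N → ∃ λ a → slot a ≡ p
  slot-surjective {zero}  _   = winit , refl
  slot-surjective {suc p} p<N = w (π ⟨$⟩ʳ fromℕ< p<N) ,
    cong suc (trans (cong toℕ (Perm.inverseˡ π)) (Finₚ.toℕ-fromℕ< p<N))

  environment : ∀ {σ} → Var N σ → ℕ
  environment (cᵛ e)  = time e
  environment (sᵛ e)  = source e
  environment (rvᵛ b) = place b

  eval : ∀ {σ} → Term (Var N) σ → ℕ
  eval (var x) = environment x
  eval 𝟘       = 0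
  eval 𝟙       = 1
  eval (t ⊕ u) = eval t + eval u

  -- The only atom t ≻ u of φ³ is the violation, which the execution does not
  -- satisfy but the critical assignment does.
  Critical : Pred (Atom (Var N)) 0ℓ
  Critical (t ≺ u) = eval t ℕ.< eval u
  Critical (t ≐ u) = eval t ≡ eval u
  Critical (t ≻ u) = ⊤

  critical? : Decidable Critical
  critical? (t ≺ u) = eval t ℕ.<? eval u
  critical? (t ≐ u) = eval t ℕ.≟ eval u
  critical? (t ≻ u) = yes _

  critical-resp-∼ : ∀ {a b} → a ∼ b → Critical a → Critical b
  critical-resp-∼ same = id
  critical-resp-∼ swap = sym

  implication : ∀ a b → (Critical a → Any (Critical ⊨_) b) → Any (Critical ⊨_) (neg a ∷ b)
  implication a b f with critical? a
  ... | yes p = there (f p)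
  ... | no ¬p = here ¬p

  clause-satisfied : ∀ {C} → EncodingClause C → Any (Critical ⊨_) C
  clause-satisfied init-before-assert    = here (s≤s z≤n)
  clause-satisfied (init-before-read i)  = here (s≤s z≤n)
  clause-satisfied (read-before-write i) = here (1+2m<2*[1+m] (place (r i)))
  clause-satisfied (clocks-distinct a≢b) = here (a≢b ∘ slot-injective ∘ ℕₚ.*-cancelˡ-≡ _ _ 2)
  clause-satisfied (writes-distinct a≢b) = here (a≢b ∘ slot-injective)
  -- Writes happen at even times and reads at odd ones.
  clause-satisfied (write≢read a b)      = here (ℕₚ.even≢odd (slot a) (place b))
  clause-satisfied (read-from a b)       = implication _ _ λ eq →
    here (s≤s (ℕₚ.≤-reflexive (cong (2 *_) eq)))
  clause-satisfied (read-init b)         = implication _ _ here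
  clause-satisfied (read-write i b)      = implication _ _ λ eq →
    here (trans (ℕₚ.+-comm (place (r i)) 1) eq)
  -- With p = `place b`, the write `a` is in slot p, so the later `a′` has slot at least p + 1, and
  -- 2p + 1 < 2(p + 1).
  clause-satisfied (from-read a a′ b)    = implication _ _ λ eq → implication _ _ λ lt →
    here (ℕₚ.<-≤-trans (1+2m<2*[1+m] (place b))
      (ℕₚ.*-monoʳ-≤ 2 (subst (ℕ._< slot a′) eq (ℕₚ.*-cancelˡ-< 2 (slot a) (slot a′) lt))))
  clause-satisfied (some-write b) with slot-surjective (place≤ b)
  ... | a , eq = Anyₚ.map⁺ (lose (write∈ a) eq)
    where
    write∈ : ∀ a → a ∈ writes N
    write∈ winit = here refl
    write∈ (w i) = there (∈-map⁺ w (∈-allFin i))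
  clause-satisfied violated = here _

  satisfied : All (Any (Critical ⊨_)) (φ³ N)
  satisfied = All.map clause-satisfied φ³-clauses

-- Models that separate two executions

-- Numbers from `k` on go up by one and smaller ones stay, so exactly the value `k` is left out.
skip : ℕ → ℕ → ℕ
skip zero    n       = suc n
skip (suc k) zero    = zero
skip (suc k) (suc n) = suc (skip k n)

skip-≤ : ∀ k n → skip k n ≤ suc n
skip-≤ zero    n       = ℕₚ.≤-refl
skip-≤ (suc k) zero    = z≤n
skip-≤ (suc k) (suc n) = s≤s (skip-≤ k n)

skip-above : ∀ {k n} → k ≤ n → skip k n ≡ suc n
skip-above z≤n       = refl
skip-above (s≤s k≤n) = cong suc (skip-above k≤n)

skip-zero : ∀ {k} → 0 ≢ k → skip k 0 ≡ 0
skip-zero {zero}  0≢0 = contradiction refl 0≢0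
skip-zero {suc k} _   = refl

skip-zero⁻¹ : ∀ k {n} → skip k n ≡ 0 → n ≡ 0
skip-zero⁻¹ (suc k) {zero} _ = refl

-- The gap made by the shift lies between `k - 1` and `k`, so only the successor pair ending in `k`
-- is torn apart.
skip-suc : ∀ k {n} → suc n ≢ k → skip k (suc n) ≡ suc (skip k n)
skip-suc zero          {n}     _   = refl
skip-suc (suc zero)    {zero}  1≢1 = contradiction refl 1≢1
skip-suc (suc (suc k)) {zero}  _   = refl
skip-suc (suc k)       {suc n} neq = cong suc (skip-suc k (neq ∘ cong suc))

-- The shift creates no new successor pair: what would have to follow `k - 1` is `k`, a value that
-- `skip k` never takes.
skip-suc⁻¹ : ∀ k {m n} → skip k m ≡ suc (skip k n) → m ≡ suc n
skip-suc⁻¹ zero          {m}         {n}     eq = ℕₚ.suc-injective eq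
skip-suc⁻¹ (suc zero)    {suc m}     {zero}  ()
skip-suc⁻¹ (suc (suc k)) {suc m}     {zero}  eq = cong suc (skip-zero⁻¹ (suc k) (ℕₚ.suc-injective eq))
skip-suc⁻¹ (suc k)       {suc m}     {suc n} eq = cong suc (skip-suc⁻¹ k (ℕₚ.suc-injective eq))

module _ {ℓ} {T : Theory ℓ} {N : ℕ} (model : HasModelWith T (2 * N + 2) (N + 1))
  (wide : WideEnough (Theory.valueTheory T) (N + 1)) (π π′ : Permutation′ N) where

  open Encoding N
  private
    module E  = Execution π
    module E′ = Execution π′
    M = proj₁ model
  open Model M
  open Theory T using (valueTheory)
  open Semantics M
  private
    module C = StrictTotalOrder clocks
    module S = Setoid selections
    module V = ValueStructure values

  instant : Fin (2 * N + 2) → C.Carrier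
  instant = proj₁ (chain clocks (proj₁ (proj₂ model)))

  instant-mono : ∀ {i j} → i Fin.< j → instant i C.< instant j
  instant-mono = proj₂ (chain clocks (proj₁ (proj₂ model)))

  selected : Fin (N + 1) → S.Carrier
  selected = Injection.to (proj₂ (proj₂ model))

  module _ (k : Fin N) (differ : π ⟨$⟩ʳ k ≢ π′ ⟨$⟩ʳ k)
           (agree : (j : Fin.Fin′ k) → π ⟨$⟩ʳ Fin.inject j ≡ π′ ⟨$⟩ʳ Fin.inject j) where

    -- The shift breaks only the link into place k, which π′ does not have, and makes the
    -- assertion fail.
    val : Read N → ℕ
    val b = skip (toℕ k) (E.place b)

    ρ : ∀ σ → Var N σ → ⟦ σ ⟧ˢ
    ρ _ (cᵛ e)  = instant (fromℕ< (E.time< e))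
    ρ _ (sᵛ e)  = selected (fromℕ< (E.source< e))
    ρ _ (rvᵛ b) = V.numeral (val b)

    before⁺ : ∀ {e e′} → E.time e ℕ.< E.time e′ → ρ _ (cᵛ e) C.< ρ _ (cᵛ e′)
    before⁺ {e} {e′} lt = instant-mono
      (subst₂ ℕ._<_ (sym (Finₚ.toℕ-fromℕ< (E.time< e))) (sym (Finₚ.toℕ-fromℕ< (E.time< e′))) lt)

    same-clock⁺ : ∀ {e e′} → E.time e ≡ E.time e′ → ρ _ (cᵛ e) C.≈ ρ _ (cᵛ e′)
    same-clock⁺ {e} {e′} eq =
      C.Eq.reflexive (cong instant (Finₚ.fromℕ<-cong _ _ eq (E.time< e) (E.time< e′)))

    before⁻ : ∀ {e e′} → ρ _ (cᵛ e) C.< ρ _ (cᵛ e′) → E.time e ℕ.< E.time e′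
    before⁻ {e} {e′} lt with ℕₚ.<-cmp (E.time e) (E.time e′)
    ... | tri< m<n _ _ = m<n
    ... | tri≈ _ m≡n _ = contradiction lt (C.irrefl (same-clock⁺ {e} {e′} m≡n))
    ... | tri> _ _ n<m = contradiction lt (C.asym (before⁺ {e′} {e} n<m))

    same-clock⁻ : ∀ {e e′} → ρ _ (cᵛ e) C.≈ ρ _ (cᵛ e′) → E.time e ≡ E.time e′
    same-clock⁻ {e} {e′} eq with ℕₚ.<-cmp (E.time e) (E.time e′)
    ... | tri< m<n _ _ = contradiction (before⁺ {e} {e′} m<n) (C.irrefl eq)
    ... | tri≈ _ m≡n _ = m≡n
    ... | tri> _ _ n<m = contradiction (before⁺ {e′} {e} n<m) (C.irrefl (C.Eq.sym eq))

    same-select⁺ : ∀ {e e′} → E.source e ≡ E.source e′ → ρ _ (sᵛ e) S.≈ ρ _ (sᵛ e′)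
    same-select⁺ {e} {e′} eq =
      S.reflexive (cong selected (Finₚ.fromℕ<-cong _ _ eq (E.source< e) (E.source< e′)))

    same-select⁻ : ∀ {e e′} → ρ _ (sᵛ e) S.≈ ρ _ (sᵛ e′) → E.source e ≡ E.source e′
    same-select⁻ {e} {e′} eq = Finₚ.fromℕ<-injective _ _ (E.source< e) (E.source< e′)
      (Injection.injective (proj₂ (proj₂ model)) eq)

    -- By minimality of `k`, both orders run thread `i` in position `j`; the inverse of `π′` then
    -- returns `j` as its place.
    agree-below : ∀ i → E.place (r i) ℕ.< toℕ k → E′.place (r i) ≡ E.place (r i)
    agree-below i lt = cong toℕ (trans (cong (π′ ⟨$⟩ˡ_) (sym π′j≡i)) (Perm.inverseˡ π′))
      where
      j = fromℕ< lt
      inject-j : Fin.inject j ≡ π ⟨$⟩ˡ i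
      inject-j = Finₚ.toℕ-injective (trans (Finₚ.toℕ-inject j) (Finₚ.toℕ-fromℕ< lt))
      π′j≡i : π′ ⟨$⟩ʳ (π ⟨$⟩ˡ i) ≡ i
      π′j≡i = trans (subst (λ x → π′ ⟨$⟩ʳ x ≡ π ⟨$⟩ʳ x) inject-j (sym (agree j))) (Perm.inverseʳ π)

    moved : ∀ b → E.place b ≡ toℕ k → E′.place b ≢ toℕ k
    -- The assertion sits at place `N`, beyond every position `k`.
    moved rassert N≡k  = contradiction (sym N≡k) (ℕₚ.<⇒≢ (Finₚ.toℕ<n k))
    moved (r i) eq eq′ = differ (trans (at-k π eq) (sym (at-k π′ eq′)))
      where
      at-k : ∀ (σ : Permutation′ N) → toℕ (σ ⟨$⟩ˡ i) ≡ toℕ k → σ ⟨$⟩ʳ k ≡ i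
      at-k σ eq = trans (cong (σ ⟨$⟩ʳ_) (sym (Finₚ.toℕ-injective eq))) (Perm.inverseʳ σ)

    first-link : ∀ b → 0 ≡ E.place b → 0 ≡ E′.place b → E.place b ≢ toℕ k
    first-link b eq eq′ at-k = moved b at-k (trans (sym eq′) (trans eq at-k))

    -- If the link ended at place `k`, thread `i` would come before `k`, where both orders agree.
    -- Then `π′` would also have `b` at place `k`, against `moved`.
    next-link : ∀ i b → suc (E.place (r i)) ≡ E.place b → suc (E′.place (r i)) ≡ E′.place b →
                E.place b ≢ toℕ k
    next-link i b eq eq′ at-k = moved b at-k (begin
      E′.place b           ≡⟨ eq′ ⟨
      suc (E′.place (r i)) ≡⟨ cong suc (agree-below i (ℕₚ.≤-reflexive (trans eq at-k))) ⟩
      suc (E.place (r i))  ≡⟨ trans eq at-k ⟩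
      toℕ k                ∎)
      where open ≡-Reasoning

    val≤ : ∀ b → val b ≤ N + 1
    val≤ b = ℕₚ.≤-trans (skip-≤ (toℕ k) (E.place b))
      (subst (suc (E.place b) ≤_) (ℕₚ.+-comm 1 N) (s≤s (E.place≤ b)))

    -- A thread has place at most `N - 1`, so its shifted value is at most `N` and the increment
    -- stays within the numerals that do not overflow.
    suc-val≤ : ∀ i → suc (val (r i)) ≤ N + 1
    suc-val≤ i = subst (suc (val (r i)) ≤_) (ℕₚ.+-comm 1 N)
      (s≤s (ℕₚ.≤-trans (skip-≤ (toℕ k) (E.place (r i))) (Finₚ.toℕ<n (π ⟨$⟩ˡ i))))

    numeral-cong : ∀ {m n} → m ≡ n → V.numeral m V.≈ V.numeral n
    numeral-cong refl = ≈-refl valueTheory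

    eval-num : ∀ n → eval ρ (num n) ≡ V.numeral n
    eval-num zero    = refl
    eval-num (suc n) = cong (V._+ V.1#) (eval-num n)

    -- Position `k` lies before the assertion, so the value read there is shifted past the bound
    -- `N`; this makes the violation true in the model.
    val-assert : val rassert ≡ suc N
    val-assert = skip-above (ℕₚ.<⇒≤ (Finₚ.toℕ<n k))

    -- Clocks and selections copy `π`. A value equation that holds in both executions does not end
    -- at place `k` and survives the shift; one that fails for `π` still fails, since the shift
    -- creates none. The violation is true in both assignments and in the model.
    agreement : ∀ {a} → EncodingAtom a →
                (E.Critical a → E′.Critical a → ⟦ ρ ⟧ᴬ a) ×
                (¬ E.Critical a → ¬ E′.Critical a → ¬ ⟦ ρ ⟧ᴬ a)
    agreement (before e e′)      = (λ p _ → before⁺ {e} {e′} p) ,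
      λ ¬p _ → ¬p ∘ before⁻ {e} {e′}
    agreement (same-clock e e′)  = (λ p _ → same-clock⁺ {e} {e′} p) ,
      λ ¬p _ → ¬p ∘ same-clock⁻ {e} {e′}
    agreement (same-select e e′) = (λ p _ → same-select⁺ {e} {e′} p) ,
      λ ¬p _ → ¬p ∘ same-select⁻ {e} {e′}
    agreement (initial b) =
      (λ p p′ → numeral-cong (sym (trans (cong (skip (toℕ k)) (sym p))
        (skip-zero (first-link b p p′ ∘ trans (sym p)))))) ,
      λ ¬p _ eq → ¬p (sym (skip-zero⁻¹ (toℕ k)
        (sym (numeral-injective valueTheory wide z≤n (val≤ b) eq))))
    agreement (increment i b) =
      (λ p p′ → numeral-cong (sym (trans (cong (skip (toℕ k)) (sym (suc-eq p)))
        (skip-suc (toℕ k) (next-link i b (suc-eq p) (suc-eq p′) ∘ trans (sym (suc-eq p))))))) ,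
      λ ¬p _ eq → ¬p (trans (ℕₚ.+-comm (E.place (r i)) 1) (sym (skip-suc⁻¹ (toℕ k)
        (sym (numeral-injective valueTheory wide (suc-val≤ i) (val≤ b) eq)))))
      where
      suc-eq : ∀ {m n} → m + 1 ≡ n → suc m ≡ n
      suc-eq {m} = trans (ℕₚ.+-comm 1 m)
    agreement assertion-violated =
      (λ _ _ → subst₂ V._<_ (sym (eval-num N)) (sym (cong V.numeral val-assert))
        (numeral-<-suc valueTheory wide (ℕₚ.≤-reflexive (ℕₚ.+-comm 1 N)))) ,
      λ ¬⊤ _ → contradiction _ ¬⊤

  executions-nonInterfering :
    ∀ {X : Set} {abs : Atom (Var N) → X} (abstraction : IsAbstraction (φ³ N) abs) → ¬ π Perm.≈ π′ →
    Refutation.NonInterfering {T = T} {φ = φ³ N} abstraction E.Critical E′.Critical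
  executions-nonInterfering abstraction π≉π′
    -- The first difference is found by search, and its minimality supplies `agree`.
    with Finₚ.¬∀⟶∃¬-smallest N (λ j → π ⟨$⟩ʳ j ≡ π′ ⟨$⟩ʳ j) (λ j → _ Finₚ.≟ _) π≉π′
  ... | k , differ , agree =
    M , ρ k differ agree , λ a∈φ → agreement k differ agree (All.lookup φ³-atoms a∈φ)

theorem4p2 : ∀ {ℓ} (T : Theory ℓ) (N : ℕ) → N ≥ 1 →
    HasModelWith T (2 * N + 2) (N + 1) → WideEnough (Theory.valueTheory T) (N + 1) →
    (X : Set) (abs : Atom (Var N) → X) → IsAbstraction (φ³ N) abs →
    (p : UnsatProof T (φ³ N) abs) → N ! ≤ learnApplications p
theorem4p2 T N _ model wide X abs abstraction =
  Refutation.nonInterfering⇒≤ {φ = φ³ N} abstraction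
    (λ k → Execution.Critical (permutations N k))
    (λ k → Execution.critical? (permutations N k))
    (λ k → Execution.critical-resp-∼ (permutations N k))
    (λ k → Execution.satisfied (permutations N k))
    (λ k l k≢l → executions-nonInterfering model wide (permutations N k) (permutations N l) abstraction
      (k≢l ∘ permutations-injective N))
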